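{- Let $i\in U$ and $x\in\mathcal P$. For every $\mu<0.5$ and $\beta>0.5+\mu$, if $\mathrm{LB}_i(x)<(0.5+\mu)\cdot \mathrm{LP}_i(x)$, then 1) $\displaystyle\sum_{t\in V} x_{it}\cdot \mathbf 1[w_{it}>\beta\cdot \mathrm{LP}_i(x)]\le \delta=\sqrt{\frac{4\mu}{\beta-0.5-\mu}}$; 2) $\displaystyle\sum_{t\in V} x_{it}\cdot w_{it}\cdot \mathbf 1[w_{it}>\beta\cdot \mathrm{LP}_i(x)]\le \frac{0.5+\mu}{1-\delta}\cdot \mathrm{LP}_i(x)$.
   Context: $U$ and $V$ are finite sets (offline and online vertices of a bipartite graph), $w_{it}\ge0$ are edge weights and $p_t\in[0,1]$ are probabilities, for $i\in U$, $t\in V$. $\mathcal P$ is the set of $x=(x_{it})_{i\in U,t\in V}$ with $x_{it}\ge0$, $\sum_{i\in U}x_{it}\le p_t$ for all $t\in V$, and $\sum_{t\in V}x_{it}\le1$ for all $i\in U$. For $x\in\mathcal P$, $\mathrm{LP}_i(x)=\sum_{t\in V} w_{it}x_{it}$ and $$\mathrm{LB}_i(x)=\max_{\tau}\ \sum_{t:\ w_{it}\ge\tau}\ \Big(\prod_{s:\ \tau\le w_{is}<w_{it}}(1-x_{is})\Big)\, x_{it}\, w_{it},$$ a lower bound on the expected weight collected at offline vertex $i$ by the best fixed-threshold algorithm (accept the first proposed edge of weight at least $\tau$) when each online vertex $t$ independently proposes to $i$ with probability $x_{it}$. One always has $\mathrm{LB}_i(x)\ge 0.5\cdot\mathrm{LP}_i(x)$,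 so the hypothesis can only hold for $\mu>0$.
   Formalization: Part 2 is stated under the added condition δ < 1: for δ = 1 its right side is undefined, and for δ > 1 it is negative while the left side is nonnegative, so the claim fails. The reals are replaced by any ordered field with decidable order and square roots, of which ℝ is classically one. -}

module Defs where

open import Algebra.Bundles using (CommutativeRing)
import Algebra.Definitions.RawMonoid as RawMonoidSum
import Algebra.Properties.Monoid.Sum as MonoidSum
import Algebra.Properties.Ring as RingProperties
open import Data.Bool.Base using (_∧_; if_then_else_)
open import Data.Fin.Base using (Fin)
import Data.List.Base as List
import Data.List.Extrema as Extrema
open import Data.List.Membership.Propositional.Properties
  using (∈-filter⁺; ∈-filter⁻; ∈-tabulate⁺; ∈-tabulate⁻)
import Data.List.Relation.Unary.All as All
open import Data.Nat.Base using (ℕ)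
open import Data.Product.Base using (_×_; _,_; ∃; proj₁; proj₂)
open import Data.Sum.Base using (inj₁; inj₂)
open import Level using (suc; _⊔_)
open import Relation.Binary.Bundles using (DecTotalOrder)
open import Relation.Binary.Core using (Rel)
import Relation.Binary.Construct.NonStrictToStrict as ToStrict
open import Relation.Binary.PropositionalEquality as ≡ using (_≡_)
open import Relation.Binary.Structures using (IsDecTotalOrder)
open import Relation.Nullary using (¬_; Dec; does; yes; no; contradiction; _×-dec_)

-- The library has no real numbers.  The properties of ℝ that the definitions
-- below rely on are collected here: a totally ordered field in which every
-- nonnegative element has a square root.  The order is decidable because
-- indicators, restricted sums and maxima over thresholds branch on it
-- (classically ℝ qualifies).  Nothing is assumed about x ⁻¹ at x ≈ 0# or about
-- sqrt x at x < 0#.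
record EuclideanField c ℓ₁ ℓ₂ : Set (suc (c ⊔ ℓ₁ ⊔ ℓ₂)) where
  infix  8 _⁻¹
  infixl 7 _/_
  infix  4 _≤_ _<_ _<?_

  field
    commutativeRing : CommutativeRing c ℓ₁

  open CommutativeRing commutativeRing public

  field
    _≤_             : Rel Carrier ℓ₂
    isDecTotalOrder : IsDecTotalOrder _≈_ _≤_
    +-monoˡ-≤       : ∀ z {x y} → x ≤ y → x + z ≤ y + z
    *-nonNeg        : ∀ {x y} → 0# ≤ x → 0# ≤ y → 0# ≤ x * y
    0≉1             : ¬ (0# ≈ 1#)
    _⁻¹             : Carrier → Carrier
    *-inverseʳ      : ∀ {x} → ¬ (x ≈ 0#) → x * x ⁻¹ ≈ 1#
    sqrt            : Carrier → Carrier
    sqrt-nonNeg     : ∀ {x} → 0# ≤ x → 0# ≤ sqrt x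
    sqrt-square     : ∀ {x} → 0# ≤ x → sqrt x * sqrt x ≈ x

  decTotalOrder : DecTotalOrder c ℓ₁ ℓ₂
  decTotalOrder = record { isDecTotalOrder = isDecTotalOrder }

  open DecTotalOrder decTotalOrder public
    using (totalOrder; _≟_; _≤?_; ≤-respˡ-≈; ≤-respʳ-≈)
    renaming ( refl to ≤-refl; reflexive to ≤-reflexive; trans to ≤-trans
             ; antisym to ≤-antisym; total to ≤-total )

  _<_ : Rel Carrier (ℓ₁ ⊔ ℓ₂)
  _<_ = ToStrict._<_ _≈_ _≤_

  _<?_ : ∀ x y → Dec (x < y)
  _<?_ = ToStrict.<-decidable _≈_ _≤_ _≟_ _≤?_

  _/_ : Carrier → Carrier → Carrier
  x / y = x * y ⁻¹

  2# 4# ½ : Carrier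
  2# = 1# + 1#
  4# = 2# + 2#
  ½  = 1# / 2#

  open RawMonoidSum +-rawMonoid public using (sum)
  open RawMonoidSum *-rawMonoid public using () renaming (sum to product)

  𝟙 : ∀ {p} {P : Set p} → Dec P → Carrier
  𝟙 d = if does d then 1# else 0#

  IsMaximum : ∀ {a} {A : Set a} → (A → Carrier) → Carrier → Set (a ⊔ ℓ₁ ⊔ ℓ₂)
  IsMaximum f m = (∃ λ a → f a ≈ m) × (∀ a → f a ≤ m)

module Order {c ℓ₁ ℓ₂} (F : EuclideanField c ℓ₁ ℓ₂) where
  open EuclideanField F
  private module R = RingProperties ring

  0≤1 : 0# ≤ 1#
  0≤1 with ≤-total 0# 1#
  ... | inj₁ p = p
  ... | inj₂ p = ≤-respʳ-≈ eq (*-nonNeg q q)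
    where
    q : 0# ≤ - 1#
    q = ≤-respˡ-≈ (-‿inverseʳ 1#) (≤-respʳ-≈ (+-identityˡ (- 1#)) (+-monoˡ-≤ (- 1#) p))
    eq : - 1# * - 1# ≈ 1#
    eq = trans (R.-1*x≈-x (- 1#)) (R.-‿involutive 1#)

  x≤x+1 : ∀ x → x ≤ x + 1#
  x≤x+1 x = ≤-respˡ-≈ (+-identityˡ x) (≤-respʳ-≈ (+-comm 1# x) (+-monoˡ-≤ x 0≤1))

  x+1≰x : ∀ x → ¬ (x + 1# ≤ x)
  x+1≰x x p = 0≉1 (R.+-cancelˡ x 0# 1#
    (trans (+-identityʳ x) (≤-antisym (x≤x+1 x) p)))

  -- A function of a threshold τ that depends on τ only through the set
  -- { t ∣ τ ≤ v t }, for finitely many levels v t, attains a maximum.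
  module Threshold {n} (v : Fin n → Carrier) (f : Carrier → Carrier)
    (f-cong : ∀ {τ τ′} → (∀ t → does (τ ≤? v t) ≡ does (τ′ ≤? v t)) → f τ ≡ f τ′)
    where

    open Extrema totalOrder

    levels : List.List Carrier
    levels = List.tabulate v

    above : Carrier
    above = max 0# levels + 1#

    above≰v : ∀ t → ¬ (above ≤ v t)
    above≰v t p = x+1≰x _
      (≤-trans p (All.lookup (xs≤max 0# levels) (∈-tabulate⁺ t)))

    round : Carrier → Carrier
    round τ = min above (List.filter (τ ≤?_) levels)

    round-≤⁺ : ∀ τ t → τ ≤ v t → round τ ≤ v t
    round-≤⁺ τ t p =
      All.lookup (min≤xs above _) (∈-filter⁺ (τ ≤?_) (∈-tabulate⁺ t) p)

    round-≤⁻ : ∀ τ t → round τ ≤ v t → τ ≤ v t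
    round-≤⁻ τ t p with argmin-sel (λ x → x) above (List.filter (τ ≤?_) levels)
    ... | inj₁ eq = contradiction (≡.subst (_≤ v t) eq p) (above≰v t)
    ... | inj₂ m  = ≤-trans (proj₂ (∈-filter⁻ (τ ≤?_) {xs = levels} m)) p

    round-does : ∀ τ t → does (τ ≤? v t) ≡ does (round τ ≤? v t)
    round-does τ t with τ ≤? v t | round τ ≤? v t
    ... | yes _ | yes _ = ≡.refl
    ... | no  _ | no  _ = ≡.refl
    ... | yes p | no ¬q = contradiction (round-≤⁺ τ t p) ¬q
    ... | no ¬p | yes q = contradiction (round-≤⁻ τ t q) ¬p

    best : Carrier
    best = argmax f above levels

    f-round≤ : ∀ τ → f (round τ) ≤ f best
    f-round≤ τ with argmin-sel (λ x → x) above (List.filter (τ ≤?_) levels)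
    ... | inj₁ eq = ≡.subst (λ z → f z ≤ f best) (≡.sym eq) (f[⊥]≤f[argmax] {f = f} above levels)
    ... | inj₂ m  = All.lookup (f[xs]≤f[argmax] {f = f} above levels)
                      (proj₁ (∈-filter⁻ (τ ≤?_) {xs = levels} m))

    maximum : ∃ (IsMaximum f)
    maximum = f best , (best , refl) ,
      λ τ → ≡.subst (_≤ f best) (≡.sym (f-cong (round-does τ))) (f-round≤ τ)

-- U is Fin k and V is Fin n.
module Matching {c ℓ₁ ℓ₂} (F : EuclideanField c ℓ₁ ℓ₂) {k n : ℕ} where
  open EuclideanField F

  record _∈𝒫_ (x : Fin k → Fin n → Carrier) (p : Fin n → Carrier) : Set (c ⊔ ℓ₂) where
    field
      nonNeg  : ∀ i t → 0# ≤ x i t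
      online  : ∀ t → sum (λ i → x i t) ≤ p t
      offline : ∀ i → sum (λ t → x i t) ≤ 1#

  module _ (w x : Fin k → Fin n → Carrier) (i : Fin k) where

    LP : Carrier
    LP = sum (λ t → w i t * x i t)

    thresholdValue : Carrier → Carrier
    thresholdValue τ = sum λ t →
      if does (τ ≤? w i t)
      then product (λ s →
             if does ((τ ≤? w i s) ×-dec (w i s <? w i t)) then 1# - x i s else 1#)
           * x i t * w i t
      else 0#

    thresholdValue-cong : ∀ {τ τ′} →
      (∀ t → does (τ ≤? w i t) ≡ does (τ′ ≤? w i t)) →
      thresholdValue τ ≡ thresholdValue τ′
    thresholdValue-cong {τ} {τ′} eq = MonoidSum.sum-cong-≗ +-monoid λ t →
      ≡.cong₂ (λ b y → if b then y * x i t * w i t else 0#) (eq t)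
        (MonoidSum.sum-cong-≗ *-monoid λ s →
          ≡.cong (λ b → if b ∧ does (w i s <? w i t) then 1# - x i s else 1#) (eq s))

    thresholdValue-maximum : ∃ (IsMaximum thresholdValue)
    thresholdValue-maximum =
      Order.Threshold.maximum F (w i) thresholdValue thresholdValue-cong

    LB : Carrier
    LB = proj₁ thresholdValue-maximum

{-# OPTIONS --safe #-}

-- Run the threshold τ = (½ + μ) LP and let q be the probability that no edge of
-- weight at least τ is proposed.  The classical prophet argument bounds the
-- value below by τ (1 - q) + q (LP - τ) = τ - 2 μ q LP.  An edge t is reached
-- with probability at least q (1 + m t), m t being the mass of the edges at least
-- as heavy as t, and not merely q.  Over the edges of weight at least β LP, of
-- total mass h, this surplus amounts to q (β - ½ - μ) LP Σ x t m t, where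
-- Σ x t m t ≥ h² / 2.  As the value stays below τ, (β - ½ - μ) h² ≤ 4 μ, i.e. h ≤ δ.
-- With the threshold β LP instead, each accepted edge is reached with
-- probability at least 1 - h ≥ 1 - δ, which gives the second bound.
module Submission where

open import Defs
open import Algebra.Bundles using (CommutativeRing)
import Algebra.Properties.Ring as RingProperties
import Algebra.Properties.CommutativeMonoid.Sum as CommutativeMonoidSum
import Algebra.Properties.Semiring.Sum as SemiringSum
import Algebra.Properties.Semiring.Mult.TCOptimised as Mult
import Algebra.Solver.Ring as RingSolver
open import Algebra.Solver.Ring.AlmostCommutativeRing
  using (fromCommutativeRing; _-Raw-AlmostCommutative⟶_)
open import Data.Bool.Base using (true; false; _∧_; if_then_else_)
open import Data.Fin.Base using (Fin; zero; suc; punchIn)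
open import Data.Integer.Base as ℤ using (ℤ; +_; -[1+_]; _⊖_)
import Data.Integer.Properties as ℤ
open import Data.Maybe.Base using (map)
open import Data.Nat.Base as ℕ using (ℕ)
import Data.Nat.Properties as ℕ
open import Data.Product.Base using (_×_; _,_; ∃; proj₁; proj₂)
open import Data.Sum.Base using (inj₁; inj₂)
open import Function.Base using (_∘_)
open import Relation.Binary.Bundles using (DecTotalOrder)
open import Relation.Binary.Consequences using (dec⇒weaklyDec)
import Relation.Binary.Construct.NonStrictToStrict as ToStrict
open import Relation.Binary.PropositionalEquality as ≡ using ()
import Relation.Binary.Reasoning.PartialOrder as PartialOrderReasoning
import Relation.Binary.Reasoning.Setoid as SetoidReasoning
open import Relation.Nullary using (¬_; Dec; does; yes; no; contradiction)

-- Integer coefficients for the ring solver.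

module IntegerCoefficients {c ℓ} (R : CommutativeRing c ℓ) where
  open CommutativeRing R
  open RingProperties ring
  open Mult semiring renaming (_×_ to _·_)
  open SetoidReasoning setoid

  -- The canonical map from the integers gives the solver coefficients with decidable equality. The
  -- multiple `1 · 1#` reduces to `1#`, so `con (+ 1)` denotes `1#` itself.
  ⟦_⟧ : ℤ → Carrier
  ⟦ + n ⟧      = n · 1#
  ⟦ -[1+ n ] ⟧ = - (ℕ.suc n · 1#)

  suc-homo : ∀ n → ℕ.suc n · 1# ≈ 1# + n · 1#
  suc-homo = ×-homo-+ 1# 1

  -‿homo : ∀ i → ⟦ ℤ.- i ⟧ ≈ - ⟦ i ⟧
  -‿homo (+ ℕ.zero)  = sym -0#≈0#
  -‿homo (+ ℕ.suc n) = refl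
  -‿homo -[1+ n ]    = sym (-‿involutive _)

  ⊖-homo : ∀ m n → ⟦ m ⊖ n ⟧ ≈ m · 1# - n · 1#
  ⊖-homo m ℕ.zero = sym (trans (+-congˡ -0#≈0#) (+-identityʳ _))
  ⊖-homo ℕ.zero (ℕ.suc n) = sym (+-identityˡ _)
  ⊖-homo (ℕ.suc m) (ℕ.suc n) = begin
    ⟦ ℕ.suc m ⊖ ℕ.suc n ⟧                  ≡⟨ ≡.cong ⟦_⟧ (ℤ.[1+m]⊖[1+n]≡m⊖n m n) ⟩
    ⟦ m ⊖ n ⟧                              ≈⟨ ⊖-homo m n ⟩
    m · 1# - n · 1#                        ≈⟨ +-congʳ (xyx⁻¹≈y 1# _) ⟨
    (1# + m · 1# - 1#) - n · 1#            ≈⟨ +-assoc _ _ _ ⟩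
    1# + m · 1# + (- 1# - n · 1#)          ≈⟨ +-congˡ (-‿+-comm 1# _) ⟩
    1# + m · 1# - (1# + n · 1#)            ≈⟨ +-cong (suc-homo m) (-‿cong (suc-homo n)) ⟨
    ℕ.suc m · 1# - ℕ.suc n · 1#            ∎

  +-homo : ∀ i j → ⟦ i ℤ.+ j ⟧ ≈ ⟦ i ⟧ + ⟦ j ⟧
  +-homo (+ m)    (+ n)    = ×-homo-+ 1# m n
  +-homo (+ m)    -[1+ n ] = ⊖-homo m (ℕ.suc n)
  +-homo -[1+ m ] (+ n)    = trans (⊖-homo n (ℕ.suc m)) (+-comm _ _)
  +-homo -[1+ m ] -[1+ n ] = begin
    - (ℕ.suc (ℕ.suc (m ℕ.+ n)) · 1#)        ≡⟨ ≡.cong (λ k → - (ℕ.suc k · 1#)) (ℕ.+-suc m n) ⟨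
    - ((ℕ.suc m ℕ.+ ℕ.suc n) · 1#)          ≈⟨ -‿cong (×-homo-+ 1# (ℕ.suc m) (ℕ.suc n)) ⟩
    - (ℕ.suc m · 1# + ℕ.suc n · 1#)         ≈⟨ -‿+-comm _ _ ⟨
    - (ℕ.suc m · 1#) - ℕ.suc n · 1#         ∎

  *-homo-+ : ∀ m j → ⟦ + m ℤ.* j ⟧ ≈ m · 1# * ⟦ j ⟧
  *-homo-+ m (+ n) = begin
    ⟦ + m ℤ.* + n ⟧    ≡⟨ ≡.cong ⟦_⟧ (ℤ.pos-* m n) ⟨
    (m ℕ.* n) · 1#     ≈⟨ ×1-homo-* m n ⟩
    m · 1# * n · 1#    ∎
  *-homo-+ m -[1+ n ] = begin
    ⟦ + m ℤ.* -[1+ n ] ⟧          ≡⟨ ≡.cong ⟦_⟧ (ℤ.neg-distribʳ-* (+ m) (+ ℕ.suc n)) ⟨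
    ⟦ ℤ.- (+ m ℤ.* + ℕ.suc n) ⟧   ≈⟨ -‿homo (+ m ℤ.* + ℕ.suc n) ⟩
    - ⟦ + m ℤ.* + ℕ.suc n ⟧       ≈⟨ -‿cong (*-homo-+ m (+ ℕ.suc n)) ⟩
    - (m · 1# * ℕ.suc n · 1#)     ≈⟨ -‿distribʳ-* _ _ ⟩
    m · 1# * - (ℕ.suc n · 1#)     ∎

  *-homo : ∀ i j → ⟦ i ℤ.* j ⟧ ≈ ⟦ i ⟧ * ⟦ j ⟧
  *-homo (+ m)    j = *-homo-+ m j
  *-homo -[1+ m ] j = begin
    ⟦ -[1+ m ] ℤ.* j ⟧            ≡⟨ ≡.cong ⟦_⟧ (ℤ.neg-distribˡ-* (+ ℕ.suc m) j) ⟨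
    ⟦ ℤ.- (+ ℕ.suc m ℤ.* j) ⟧     ≈⟨ -‿homo (+ ℕ.suc m ℤ.* j) ⟩
    - ⟦ + ℕ.suc m ℤ.* j ⟧         ≈⟨ -‿cong (*-homo-+ (ℕ.suc m) j) ⟩
    - (ℕ.suc m · 1# * ⟦ j ⟧)      ≈⟨ -‿distribˡ-* _ _ ⟩
    - (ℕ.suc m · 1#) * ⟦ j ⟧      ∎

  homomorphism : ℤ.+-*-rawRing -Raw-AlmostCommutative⟶ fromCommutativeRing R
  homomorphism = record
    { ⟦_⟧    = ⟦_⟧
    ; +-homo = +-homo
    ; *-homo = *-homo
    ; -‿homo = -‿homo
    ; 0-homo = refl
    ; 1-homo = refl
    }

  open RingSolver ℤ.+-*-rawRing (fromCommutativeRing R) homomorphism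
    (λ i j → map (λ eq → reflexive (≡.cong ⟦_⟧ eq)) (dec⇒weaklyDec ℤ._≟_ i j))
    using (solve; _:=_; _:+_; _:*_; _:-_; con) public

-- Inequalities, square roots, finite sums and products in an ordered field.

module OrderedField {c ℓ₁ ℓ₂} (F : EuclideanField c ℓ₁ ℓ₂) where
  open EuclideanField F hiding (zero)
  open Order F using (0≤1; x≤x+1)
  open IntegerCoefficients commutativeRing
    using (solve; _:=_; _:+_; _:*_; _:-_; con)

  if-elim : ∀ {p q} {P : Set p} (Q : Carrier → Set q) (d : Dec P) {x y} →
            (P → Q x) → (¬ P → Q y) → Q (if does d then x else y)
  if-elim Q (yes p) f g = f p
  if-elim Q (no ¬p) f g = g ¬p

  x≤y⇒0≤y-x : ∀ {x y} → x ≤ y → 0# ≤ y - x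
  x≤y⇒0≤y-x {x} x≤y = ≤-respˡ-≈ (-‿inverseʳ x) (+-monoˡ-≤ (- x) x≤y)

  0≤y-x⇒x≤y : ∀ {x y} → 0# ≤ y - x → x ≤ y
  0≤y-x⇒x≤y {x} {y} 0≤y-x =
    ≤-respˡ-≈ (+-identityˡ x)
      (≤-respʳ-≈ (solve 2 (λ x y → y :- x :+ x := y) refl x y) (+-monoˡ-≤ x 0≤y-x))

  -- Splits an inequality into a ring identity for `y - x`, left to `solve`, and the nonnegativity
  -- of a visibly nonnegative expression. Most estimates below take this shape.
  ≤-by-difference : ∀ {x y d} → y - x ≈ d → 0# ≤ d → x ≤ y
  ≤-by-difference eq 0≤d = 0≤y-x⇒x≤y (≤-respʳ-≈ (sym eq) 0≤d)

  +-mono-≤ : ∀ {x y u v} → x ≤ y → u ≤ v → x + u ≤ y + v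
  +-mono-≤ {x} {y} {u} {v} x≤y u≤v = ≤-trans (+-monoˡ-≤ u x≤y)
    (≤-respˡ-≈ (+-comm u y) (≤-respʳ-≈ (+-comm v y) (+-monoˡ-≤ y u≤v)))

  +-nonNeg : ∀ {x y} → 0# ≤ x → 0# ≤ y → 0# ≤ x + y
  +-nonNeg 0≤x 0≤y = ≤-respˡ-≈ (+-identityˡ 0#) (+-mono-≤ 0≤x 0≤y)

  *-monoˡ-≤ : ∀ {x y z} → 0# ≤ z → x ≤ y → z * x ≤ z * y
  *-monoˡ-≤ {x} {y} {z} 0≤z x≤y = ≤-by-difference
    (solve 3 (λ x y z → z :* y :- z :* x := z :* (y :- x)) refl x y z)
    (*-nonNeg 0≤z (x≤y⇒0≤y-x x≤y))

  *-mono-≤ : ∀ {x y u v} → 0# ≤ x → 0# ≤ u → x ≤ y → u ≤ v → x * u ≤ y * v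
  *-mono-≤ {x} {y} {u} {v} 0≤x 0≤u x≤y u≤v = ≤-trans (*-monoˡ-≤ 0≤x u≤v)
    (≤-respˡ-≈ (*-comm v x) (≤-respʳ-≈ (*-comm v y)
      (*-monoˡ-≤ (≤-trans 0≤u u≤v) x≤y)))

  <⇒≤ : ∀ {x y} → x < y → x ≤ y
  <⇒≤ = proj₁

  ≮⇒≥ : ∀ {x y} → ¬ (x < y) → y ≤ x
  ≮⇒≥ = ToStrict.≮⇒≥ _≈_ _≤_ sym _≟_ ≤-reflexive ≤-total

  <⇒≱ : ∀ {x y} → x < y → ¬ (y ≤ x)
  <⇒≱ = ToStrict.<⇒≱ _≈_ _≤_ ≤-antisym

  ≰⇒≥ : ∀ {x y} → ¬ (x ≤ y) → y ≤ x
  ≰⇒≥ {x} {y} x≰y with ≤-total x y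
  ... | inj₁ x≤y = contradiction x≤y x≰y
  ... | inj₂ y≤x = y≤x

  x<y⇒0<y-x : ∀ {x y} → x < y → 0# < y - x
  x<y⇒0<y-x {x} {y} (x≤y , x≉y) = x≤y⇒0≤y-x x≤y , λ 0≈y-x → x≉y (begin
    x            ≈⟨ +-identityˡ x ⟨
    0# + x       ≈⟨ +-congʳ 0≈y-x ⟩
    y - x + x    ≈⟨ solve 2 (λ x y → y :- x :+ x := y) refl x y ⟩
    y            ∎)
    where open SetoidReasoning setoid

  0<x⇒x*x⁻¹≈1 : ∀ {x} → 0# < x → x * x ⁻¹ ≈ 1#
  0<x⇒x*x⁻¹≈1 (_ , 0≉x) = *-inverseʳ (0≉x ∘ sym)

  -- If `x ⁻¹` were nonpositive, so would be `x * x ⁻¹ ≈ 1#`.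
  ⁻¹-nonNeg : ∀ {x} → 0# < x → 0# ≤ x ⁻¹
  ⁻¹-nonNeg {x} 0<x with ≤-total 0# (x ⁻¹)
  ... | inj₁ 0≤x⁻¹ = 0≤x⁻¹
  ... | inj₂ x⁻¹≤0 = contradiction (≤-antisym 0≤1 1≤0) 0≉1
    where
    1≤0 : 1# ≤ 0#
    1≤0 = ≤-by-difference
      (trans (+-congˡ (-‿cong (sym (0<x⇒x*x⁻¹≈1 0<x))))
        (solve 2 (λ x y → con (+ 0) :- x :* y := x :* (con (+ 0) :- y)) refl x (x ⁻¹)))
      (*-nonNeg (<⇒≤ 0<x) (x≤y⇒0≤y-x x⁻¹≤0))

  z*x≤y⇒x≤y/z : ∀ {x y z} → 0# < z → z * x ≤ y → x ≤ y / z
  z*x≤y⇒x≤y/z {x} {y} {z} 0<z zx≤y = ≤-by-difference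
    (begin
      y / z - x                 ≈⟨ +-congˡ (-‿cong (*-identityʳ x)) ⟨
      y / z - x * 1#            ≈⟨ +-congˡ (-‿cong (*-congˡ (0<x⇒x*x⁻¹≈1 0<z))) ⟨
      y / z - x * (z * z ⁻¹)    ≈⟨ solve 4 (λ x y z i → y :* i :- x :* (z :* i)
                                                     := (y :- z :* x) :* i) refl x y z (z ⁻¹) ⟩
      (y - z * x) * z ⁻¹        ∎)
    (*-nonNeg (x≤y⇒0≤y-x zx≤y) (⁻¹-nonNeg 0<z))
    where open SetoidReasoning setoid

  0<2 : 0# < 2#
  0<2 = ≤-trans 0≤1 (x≤x+1 1#) , λ 0≈2 →
    0≉1 (≤-antisym 0≤1 (≤-respʳ-≈ (sym 0≈2) (x≤x+1 1#)))

  2*½≈1 : 2# * ½ ≈ 1#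
  2*½≈1 = trans (*-congˡ (*-identityˡ _)) (0<x⇒x*x⁻¹≈1 0<2)

  -- Suppose `s < x` for `s = sqrt y`. As `x * x ≤ s * s`, the product `(x - s) * x` is nonpositive;
  -- dividing by `x - s` gives `x ≤ 0# ≤ s`, a contradiction.
  x*x≤y⇒x≤sqrt : ∀ {x y} → x * x ≤ y → 0# ≤ y → x ≤ sqrt y
  x*x≤y⇒x≤sqrt {x} {y} x²≤y 0≤y = ≮⇒≥ λ s<x →
    <⇒≱ s<x (≤-trans (≤-respʳ-≈ (zeroˡ _) (z*x≤y⇒x≤y/z (x<y⇒0<y-x s<x) (bound s<x))) 0≤s)
    where
    s : Carrier
    s = sqrt y
    0≤s : 0# ≤ s
    0≤s = sqrt-nonNeg 0≤y
    bound : s < x → (x - s) * x ≤ 0#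
    bound s<x = ≤-by-difference
      (solve 2 (λ x s → con (+ 0) :- (x :- s) :* x
                     := (s :* s :- x :* x) :+ s :* (x :- s)) refl x s)
      (+-nonNeg (x≤y⇒0≤y-x (≤-respʳ-≈ (sym (sqrt-square 0≤y)) x²≤y))
                (*-nonNeg 0≤s (x≤y⇒0≤y-x (<⇒≤ s<x))))

  maximal : ∀ {n} (v : Fin (ℕ.suc n) → Carrier) → ∃ λ m → ∀ t → v t ≤ v m
  maximal {ℕ.zero}  v = zero , λ { zero → ≤-refl }
  maximal {ℕ.suc n} v with maximal (v ∘ suc)
  ... | m , vt≤vm with ≤-total (v zero) (v (suc m))
  ...   | inj₁ v₀≤vm = suc m , λ { zero → v₀≤vm ; (suc t) → vt≤vm t }
  ...   | inj₂ vm≤v₀ = zero  , λ { zero → ≤-refl ; (suc t) → ≤-trans (vt≤vm t) vm≤v₀ }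

  sum-mono-≤ : ∀ {n} {f g : Fin n → Carrier} → (∀ t → f t ≤ g t) → sum f ≤ sum g
  sum-mono-≤ {ℕ.zero}  f≤g = ≤-refl
  sum-mono-≤ {ℕ.suc n} f≤g = +-mono-≤ (f≤g zero) (sum-mono-≤ (f≤g ∘ suc))

  sum-nonNeg : ∀ {n} {f : Fin n → Carrier} → (∀ t → 0# ≤ f t) → 0# ≤ sum f
  sum-nonNeg {ℕ.zero}  0≤f = ≤-refl
  sum-nonNeg {ℕ.suc n} 0≤f = +-nonNeg (0≤f zero) (sum-nonNeg (0≤f ∘ suc))

  term≤sum : ∀ {n} {f : Fin n → Carrier} → (∀ t → 0# ≤ f t) → ∀ t → f t ≤ sum f
  term≤sum 0≤f zero    = ≤-respˡ-≈ (+-identityʳ _) (+-mono-≤ ≤-refl (sum-nonNeg (0≤f ∘ suc)))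
  term≤sum 0≤f (suc t) = ≤-respˡ-≈ (+-identityˡ _) (+-mono-≤ (0≤f zero) (term≤sum (0≤f ∘ suc) t))

  product-nonNeg : ∀ {n} {f : Fin n → Carrier} → (∀ t → 0# ≤ f t) → 0# ≤ product f
  product-nonNeg {ℕ.zero}  0≤f = 0≤1
  product-nonNeg {ℕ.suc n} 0≤f = *-nonNeg (0≤f zero) (product-nonNeg (0≤f ∘ suc))

  product-mono-≤ : ∀ {n} {f g : Fin n → Carrier} → (∀ t → 0# ≤ f t) →
                   (∀ t → f t ≤ g t) → product f ≤ product g
  product-mono-≤ {ℕ.zero}  0≤f f≤g = ≤-refl
  product-mono-≤ {ℕ.suc n} 0≤f f≤g = *-mono-≤ (0≤f zero) (product-nonNeg (0≤f ∘ suc))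
    (f≤g zero) (product-mono-≤ (0≤f ∘ suc) (f≤g ∘ suc))

-- Survival probabilities of independent proposals.

module Thinning {c ℓ₁ ℓ₂} (F : EuclideanField c ℓ₁ ℓ₂) where
  open EuclideanField F hiding (zero)
  open Order F using (0≤1)
  open OrderedField F
  open IntegerCoefficients commutativeRing
    using (solve; _:=_; _:+_; _:*_; _:-_; con)
  open SemiringSum semiring
    using (sum-cong-≋; sum-remove; ∑-distrib-+; ∑-comm; *-distribˡ-sum; *-distribʳ-sum)
  module Product = CommutativeMonoidSum *-commutativeMonoid

  restrict : ∀ {p} {P : Set p} → Dec P → Carrier → Carrier
  restrict d x = if does d then x else 0#

  restrict-nonNeg : ∀ {p} {P : Set p} (d : Dec P) {x} → 0# ≤ x → 0# ≤ restrict d x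
  restrict-nonNeg d 0≤x = if-elim (0# ≤_) d (λ _ → 0≤x) (λ _ → ≤-refl)

  restrict-≤ : ∀ {p} {P : Set p} (d : Dec P) {x} → 0# ≤ x → restrict d x ≤ x
  restrict-≤ d {x} 0≤x = if-elim (_≤ x) d (λ _ → ≤-refl) (λ _ → 0≤x)

  -- When each `s` proposes independently with probability `a s`, this is the chance that nobody
  -- proposes. `surviveBelow` is the chance of no proposal of value below `u`, and `massFrom` the
  -- expected number of proposals of value at least `u`.
  surviveAll : ∀ {n} → (Fin n → Carrier) → Carrier
  surviveAll a = product (λ s → 1# - a s)

  surviveBelow : ∀ {n} → (v a : Fin n → Carrier) → Carrier → Carrier
  surviveBelow v a u = product (λ s → if does (v s <? u) then 1# - a s else 1#)

  massFrom : ∀ {n} → (v a : Fin n → Carrier) → Carrier → Carrier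
  massFrom v a u = sum (λ s → restrict (u ≤? v s) (a s))

  surviveAll-nonNeg : ∀ {n} {a : Fin n → Carrier} → (∀ t → a t ≤ 1#) → 0# ≤ surviveAll a
  surviveAll-nonNeg a≤1 = product-nonNeg (x≤y⇒0≤y-x ∘ a≤1)

  surviveBelow-nonNeg : ∀ {n} (v : Fin n → Carrier) {a} → (∀ t → a t ≤ 1#) →
                        ∀ u → 0# ≤ surviveBelow v a u
  surviveBelow-nonNeg v a≤1 u = product-nonNeg λ s →
    if-elim (0# ≤_) (v s <? u) (λ _ → x≤y⇒0≤y-x (a≤1 s)) (λ _ → 0≤1)

  massFrom-nonNeg : ∀ {n} (v : Fin n → Carrier) {a} → (∀ t → 0# ≤ a t) →
                    ∀ u → 0# ≤ massFrom v a u
  massFrom-nonNeg v 0≤a u = sum-nonNeg λ s → restrict-nonNeg (u ≤? v s) (0≤a s)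

  1-a≤1 : ∀ {a} → 0# ≤ a → 1# - a ≤ 1#
  1-a≤1 {a} 0≤a = ≤-by-difference
    (solve 1 (λ a → con (+ 1) :- (con (+ 1) :- a) := a) refl a) 0≤a

  surviveAll≤surviveBelow : ∀ {n} (v : Fin n → Carrier) {a} →
    (∀ t → 0# ≤ a t) → (∀ t → a t ≤ 1#) → ∀ u → surviveAll a ≤ surviveBelow v a u
  surviveAll≤surviveBelow v {a} 0≤a a≤1 u = product-mono-≤ (x≤y⇒0≤y-x ∘ a≤1) λ s →
    if-elim (1# - a s ≤_) (v s <? u) (λ _ → ≤-refl) (λ _ → 1-a≤1 (0≤a s))

  -- The union bound, by induction: with one more element the slack is `1# - a` times the old slack,
  -- plus the nonnegative product of `a` with the remaining sum.
  1-sum≤surviveAll : ∀ {n} {a : Fin n → Carrier} → (∀ t → 0# ≤ a t) → (∀ t → a t ≤ 1#) →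
                     1# - sum a ≤ surviveAll a
  1-sum≤surviveAll {ℕ.zero} 0≤a a≤1 =
    ≤-reflexive (solve 0 (con (+ 1) :- con (+ 0) := con (+ 1)) refl)
  1-sum≤surviveAll {ℕ.suc n} {a} 0≤a a≤1 = ≤-by-difference
    (solve 3 (λ a s q → (con (+ 1) :- a) :* q :- (con (+ 1) :- (a :+ s))
                     := (con (+ 1) :- a) :* (q :- (con (+ 1) :- s)) :+ a :* s)
      refl (a zero) (sum (a ∘ suc)) (surviveAll (a ∘ suc)))
    (+-nonNeg
      (*-nonNeg (x≤y⇒0≤y-x (a≤1 zero)) (x≤y⇒0≤y-x (1-sum≤surviveAll (0≤a ∘ suc) (a≤1 ∘ suc))))
      (*-nonNeg (0≤a zero) (sum-nonNeg (0≤a ∘ suc))))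

  -- A division-free upper bound for the survival probability. Since `(1# - a) * (1# + a + s)`
  -- equals `1# + s` minus `a * (a + s)`, a further element can only decrease the left side.
  surviveAll*[1+sum]≤1 : ∀ {n} {a : Fin n → Carrier} → (∀ t → 0# ≤ a t) → (∀ t → a t ≤ 1#) →
                         surviveAll a * (1# + sum a) ≤ 1#
  surviveAll*[1+sum]≤1 {ℕ.zero} 0≤a a≤1 =
    ≤-reflexive (solve 0 (con (+ 1) :* (con (+ 1) :+ con (+ 0)) := con (+ 1)) refl)
  surviveAll*[1+sum]≤1 {ℕ.suc n} {a} 0≤a a≤1 = ≤-by-difference
    (solve 3 (λ a s q → con (+ 1) :- (con (+ 1) :- a) :* q :* (con (+ 1) :+ (a :+ s))
                     := (con (+ 1) :- q :* (con (+ 1) :+ s)) :+ q :* (a :* a :+ a :* s))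
      refl (a zero) (sum (a ∘ suc)) (surviveAll (a ∘ suc)))
    (+-nonNeg
      (x≤y⇒0≤y-x (surviveAll*[1+sum]≤1 (0≤a ∘ suc) (a≤1 ∘ suc)))
      (*-nonNeg (surviveAll-nonNeg (a≤1 ∘ suc))
        (+-nonNeg (*-nonNeg (0≤a zero) (0≤a zero))
                  (*-nonNeg (0≤a zero) (sum-nonNeg (0≤a ∘ suc))))))

  -- Exactly one of `v s < u` and `u ≤ v s` holds, so each factor `1# - a s` occurs in exactly one
  -- of the two products.
  surviveBelow*surviveFrom : ∀ {n} (v a : Fin n → Carrier) u →
    surviveBelow v a u * surviveAll (λ s → restrict (u ≤? v s) (a s)) ≈ surviveAll a
  surviveBelow*surviveFrom v a u =
    trans (sym (Product.∑-distrib-+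
      (λ s → if does (v s <? u) then 1# - a s else 1#) (λ s → 1# - restrict (u ≤? v s) (a s))))
    (Product.sum-cong-≋ λ s →
      complementary (v s <? u) (u ≤? v s) <⇒≱ ≮⇒≥ (a s))
    where
    complementary : ∀ {p q} {P : Set p} {Q : Set q} (d : Dec P) (e : Dec Q) →
                    (P → ¬ Q) → (¬ P → Q) → ∀ x →
                    (if does d then 1# - x else 1#) * (1# - restrict e x) ≈ 1# - x
    complementary (yes p) (yes q) P⇒¬Q ¬P⇒Q x = contradiction q (P⇒¬Q p)
    complementary (yes p) (no ¬q) P⇒¬Q ¬P⇒Q x =
      solve 1 (λ x → (con (+ 1) :- x) :* (con (+ 1) :- con (+ 0)) := con (+ 1) :- x) refl x
    complementary (no ¬p) (yes q) P⇒¬Q ¬P⇒Q x = *-identityˡ _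
    complementary (no ¬p) (no ¬q) P⇒¬Q ¬P⇒Q x = contradiction (¬P⇒Q ¬p) ¬q

  -- Sharpens `surviveAll≤surviveBelow` and is the source of the surplus: `surviveAll` contains the
  -- extra factor of the elements from `u` upwards, and that factor times `1#` plus their mass is at
  -- most `1#`.
  surviveAll*[1+massFrom]≤surviveBelow : ∀ {n} (v : Fin n → Carrier) {a} →
    (∀ t → 0# ≤ a t) → (∀ t → a t ≤ 1#) → ∀ u →
    surviveAll a * (1# + massFrom v a u) ≤ surviveBelow v a u
  surviveAll*[1+massFrom]≤surviveBelow v {a} 0≤a a≤1 u = begin
    surviveAll a * (1# + sum b)
      ≈⟨ *-congʳ (surviveBelow*surviveFrom v a u) ⟨
    surviveBelow v a u * surviveAll b * (1# + sum b)
      ≈⟨ *-assoc _ _ _ ⟩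
    surviveBelow v a u * (surviveAll b * (1# + sum b))
      ≤⟨ *-monoˡ-≤ (surviveBelow-nonNeg v a≤1 u) (surviveAll*[1+sum]≤1 0≤b b≤1) ⟩
    surviveBelow v a u * 1#
      ≈⟨ *-identityʳ _ ⟩
    surviveBelow v a u ∎
    where
    open PartialOrderReasoning (DecTotalOrder.poset decTotalOrder)
    b : _ → Carrier
    b s = restrict (u ≤? v s) (a s)
    0≤b : ∀ s → 0# ≤ b s
    0≤b s = restrict-nonNeg (u ≤? v s) (0≤a s)
    b≤1 : ∀ s → b s ≤ 1#
    b≤1 s = ≤-trans (restrict-≤ (u ≤? v s) (0≤a s)) (a≤1 s)

  -- Strict only when values tie.  Removing an element of maximal value leaves
  -- the other survival probabilities unchanged, whence the induction.
  1-surviveAll≤sum : ∀ {n} (v : Fin n → Carrier) {a} → (∀ t → 0# ≤ a t) → (∀ t → a t ≤ 1#) →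
                     1# - surviveAll a ≤ sum (λ t → a t * surviveBelow v a (v t))
  1-surviveAll≤sum {ℕ.zero} v 0≤a a≤1 = ≤-reflexive (-‿inverseʳ 1#)
  1-surviveAll≤sum {ℕ.suc n} v {a} 0≤a a≤1 = begin
    1# - surviveAll a
      ≈⟨ +-congˡ (-‿cong (Product.sum-remove (λ s → 1# - a s))) ⟩
    1# - (1# - a m) * q
      ≈⟨ solve 2 (λ a q → con (+ 1) :- (con (+ 1) :- a) :* q := a :* q :+ (con (+ 1) :- q)) refl (a m) q ⟩
    a m * q + (1# - q)
      ≤⟨ +-mono-≤ (*-monoˡ-≤ (0≤a m) q≤below) (1-surviveAll≤sum v′ (0≤a ∘ punchIn m) (a≤1 ∘ punchIn m)) ⟩
    a m * surviveBelow v a (v m) + sum (λ t → a′ t * surviveBelow v′ a′ (v′ t))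
      ≈⟨ +-congˡ (sum-cong-≋ (λ t → *-congˡ (below-remove (v′ t) (vt≤vm (punchIn m t))))) ⟨
    a m * surviveBelow v a (v m) + sum (λ t → a′ t * surviveBelow v a (v′ t))
      ≈⟨ sum-remove (λ t → a t * surviveBelow v a (v t)) ⟨
    sum (λ t → a t * surviveBelow v a (v t)) ∎
    where
    open PartialOrderReasoning (DecTotalOrder.poset decTotalOrder)
    m : Fin (ℕ.suc n)
    m = proj₁ (maximal v)
    vt≤vm : ∀ t → v t ≤ v m
    vt≤vm = proj₂ (maximal v)
    v′ a′ : Fin n → Carrier
    v′ = v ∘ punchIn m
    a′ = a ∘ punchIn m
    q : Carrier
    q = surviveAll a′
    below-remove : ∀ u → u ≤ v m → surviveBelow v a u ≈ surviveBelow v′ a′ u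
    below-remove u u≤vm = trans
      (Product.sum-remove (λ s → if does (v s <? u) then 1# - a s else 1#)) (trans
      (*-congʳ (if-elim (_≈ 1#) (v m <? u)
        (λ vm<u → contradiction u≤vm (<⇒≱ vm<u)) (λ _ → refl)))
      (*-identityˡ _))
    q≤below : q ≤ surviveBelow v a (v m)
    q≤below = ≤-respʳ-≈ (sym (below-remove (v m) ≤-refl))
      (surviveAll≤surviveBelow v′ (0≤a ∘ punchIn m) (a≤1 ∘ punchIn m) (v m))

  -- Every pair (t, s) is counted at least once by v t ≤ v s or by v s ≤ v t.
  sum²≤2*sum*massFrom : ∀ {n} (v : Fin n → Carrier) {a} → (∀ t → 0# ≤ a t) →
    sum a * sum a ≤ 2# * sum (λ t → a t * massFrom v a (v t))
  sum²≤2*sum*massFrom v {a} 0≤a = begin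
    sum a * sum a
      ≈⟨ *-distribʳ-sum (sum a) a ⟩
    sum (λ t → a t * sum a)
      ≈⟨ sum-cong-≋ (λ t → *-distribˡ-sum (a t) a) ⟩
    sum (λ t → sum (λ s → a t * a s))
      ≤⟨ sum-mono-≤ (λ t → sum-mono-≤ (λ s → pair t s)) ⟩
    sum (λ t → sum (λ s → ab t s + ab s t))
      ≈⟨ sum-cong-≋ (λ t → ∑-distrib-+ (ab t) (λ s → ab s t)) ⟩
    sum (λ t → sum (ab t) + sum (λ s → ab s t))
      ≈⟨ ∑-distrib-+ (λ t → sum (ab t)) (λ t → sum (λ s → ab s t)) ⟩
    sum (λ t → sum (ab t)) + sum (λ t → sum (λ s → ab s t))
      ≈⟨ +-congˡ (∑-comm (λ t s → ab s t)) ⟩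
    sum (λ t → sum (ab t)) + sum (λ t → sum (ab t))
      ≈⟨ solve 1 (λ x → x :+ x := (con (+ 1) :+ con (+ 1)) :* x) refl _ ⟩
    2# * sum (λ t → sum (ab t))
      ≈⟨ *-congˡ (sum-cong-≋ (λ t → *-distribˡ-sum (a t) (λ s → restrict (v t ≤? v s) (a s)))) ⟨
    2# * sum (λ t → a t * massFrom v a (v t)) ∎
    where
    open PartialOrderReasoning (DecTotalOrder.poset decTotalOrder)
    ab : _ → _ → Carrier
    ab t s = a t * restrict (v t ≤? v s) (a s)
    0≤ab : ∀ t s → 0# ≤ ab t s
    0≤ab t s = *-nonNeg (0≤a t) (restrict-nonNeg (v t ≤? v s) (0≤a s))
    pair : ∀ t s → a t * a s ≤ ab t s + ab s t
    pair t s with v t ≤? v s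
    ... | yes _ = ≤-respˡ-≈ (+-identityʳ _) (+-mono-≤ ≤-refl (0≤ab s t))
    ... | no ¬p with v s ≤? v t
    ...   | yes _ = ≤-reflexive
      (solve 2 (λ x y → x :* y := x :* con (+ 0) :+ y :* x) refl (a t) (a s))
    ...   | no ¬q = contradiction (≰⇒≥ ¬p) ¬q

-- The value of a fixed threshold and the prophet inequality.

module FixedThreshold {c ℓ₁ ℓ₂} (F : EuclideanField c ℓ₁ ℓ₂) where
  open EuclideanField F hiding (zero)
  open Order F using (0≤1)
  open OrderedField F
  open Thinning F
  open IntegerCoefficients commutativeRing
    using (solve; _:=_; _:+_; _:*_; _:-_; con)
  open SemiringSum semiring
    using (sum-cong-≋; ∑-distrib-+; *-distribˡ-sum)

  -- Moves the threshold from the index set into the probabilities, so that the results on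
  -- independent proposals apply with `a = cut w x τ`.
  cut : ∀ {n} → (w x : Fin n → Carrier) → Carrier → Fin n → Carrier
  cut w x τ t = restrict (τ ≤? w t) (x t)

  value : ∀ {n} → (w x : Fin n → Carrier) → Carrier → Carrier
  value w x τ = sum (λ t → cut w x τ t * surviveBelow w (cut w x τ) (w t) * w t)

  -- An edge below `τ` has probability `0#` after the cut: its summand vanishes and its factor in
  -- every product becomes `1# - 0#`.
  thresholdValue≈value : ∀ {k n} (w x : Fin k → Fin n → Carrier) i τ →
    Matching.thresholdValue F w x i τ ≈ value (w i) (x i) τ
  thresholdValue≈value w x i τ = sum-cong-≋ λ t →
    term (τ ≤? w i t) (trans (*-comm _ _) (*-congˡ (Product.sum-cong-≋ λ s →
      factor (does (τ ≤? w i s)) (does (w i s <? w i t)) (x i s))))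
    where
    -- The conjunction `_×-dec_` computes to `_∧_` under `does`, so two booleans settle the
    -- comparison.
    factor : ∀ b b′ y → (if b ∧ b′ then 1# - y else 1#)
                      ≈ (if b′ then 1# - (if b then y else 0#) else 1#)
    factor false false y = refl
    factor false true  y = solve 0 (con (+ 1) := con (+ 1) :- con (+ 0)) refl
    factor true  false y = refl
    factor true  true  y = refl
    term : ∀ {p} {P : Set p} (d : Dec P) {g g′ y u} → g * y ≈ y * g′ →
           (if does d then g * y * u else 0#) ≈ restrict d y * g′ * u
    term (yes _) eq = *-congʳ eq
    term (no  _) eq = sym (trans (*-congʳ (zeroˡ _)) (zeroˡ _))

  module _ {n} (w x : Fin n → Carrier) (0≤w : ∀ t → 0# ≤ w t) (0≤x : ∀ t → 0# ≤ x t)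
           (∑x≤1 : sum x ≤ 1#) where

    x≤1 : ∀ t → x t ≤ 1#
    x≤1 t = ≤-trans (term≤sum 0≤x t) ∑x≤1

    cut-nonNeg : ∀ τ t → 0# ≤ cut w x τ t
    cut-nonNeg τ t = restrict-nonNeg (τ ≤? w t) (0≤x t)

    cut≤1 : ∀ τ t → cut w x τ t ≤ 1#
    cut≤1 τ t = ≤-trans (restrict-≤ (τ ≤? w t) (0≤x t)) (x≤1 t)

    cut-antitone : ∀ {τ τ′} → τ ≤ τ′ → ∀ t → cut w x τ′ t ≤ cut w x τ t
    cut-antitone {τ} {τ′} τ≤τ′ t with τ′ ≤? w t | τ ≤? w t
    ... | yes _ | yes _ = ≤-refl
    ... | yes p | no ¬q = contradiction (≤-trans τ≤τ′ p) ¬q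
    ... | no  _ | yes _ = 0≤x t
    ... | no  _ | no  _ = ≤-refl

    value-nonNeg : ∀ τ → 0# ≤ value w x τ
    value-nonNeg τ = sum-nonNeg λ t →
      *-nonNeg (*-nonNeg (cut-nonNeg τ t) (surviveBelow-nonNeg w (cut≤1 τ) (w t))) (0≤w t)

    -- Each edge above `τ` is reached at least when nothing is proposed at all, which by the union
    -- bound has probability at least `1# - sum (cut w x τ)`. This serves the bound on the heavy
    -- weight.
    [1-sum]*sum≤value : ∀ τ →
      (1# - sum (cut w x τ)) * sum (λ t → cut w x τ t * w t) ≤ value w x τ
    [1-sum]*sum≤value τ = ≤-respˡ-≈ (sym (*-distribˡ-sum _ (λ t → cut w x τ t * w t))) (sum-mono-≤ λ t →
      ≤-by-difference
        (solve 4 (λ a w g h → a :* g :* w :- h :* (a :* w) := a :* w :* (g :- h)) refl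
          (cut w x τ t) (w t) _ _)
        (*-nonNeg (*-nonNeg (cut-nonNeg τ t) (0≤w t)) (x≤y⇒0≤y-x (≤-trans
          (1-sum≤surviveAll (cut-nonNeg τ) (cut≤1 τ))
          (surviveAll≤surviveBelow w (cut-nonNeg τ) (cut≤1 τ) (w t))))))

    -- The positive part of `w t - τ`, weighted by `x t`: the cut already vanishes where the
    -- difference is negative.
    excess : Carrier → Fin n → Carrier
    excess τ t = cut w x τ t * (w t - τ)

    excess-nonNeg : ∀ τ t → 0# ≤ excess τ t
    excess-nonNeg τ t with τ ≤? w t
    ... | yes τ≤w = *-nonNeg (0≤x t) (x≤y⇒0≤y-x τ≤w)
    ... | no  _   = ≤-reflexive (sym (zeroˡ _))

    -- Each `w t` is at most `τ` plus the positive part of `w t - τ`, and the `τ` terms total at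
    -- most `τ` because `sum x ≤ 1#`.
    sum-τ≤sum-excess : ∀ {τ} → 0# ≤ τ → sum (λ t → w t * x t) - τ ≤ sum (excess τ)
    sum-τ≤sum-excess {τ} 0≤τ = begin
      sum (λ t → w t * x t) - τ
        ≤⟨ +-monoˡ-≤ (- τ) (sum-mono-≤ split) ⟩
      sum (λ t → excess τ t + τ * x t) - τ
        ≈⟨ +-congʳ (trans (∑-distrib-+ (excess τ) (λ t → τ * x t))
             (+-congˡ (sym (*-distribˡ-sum τ x)))) ⟩
      sum (excess τ) + τ * sum x - τ
        ≤⟨ ≤-by-difference
             (solve 3 (λ e τ s → e :- (e :+ τ :* s :- τ) := τ :* (con (+ 1) :- s)) refl
               (sum (excess τ)) τ (sum x))
             (*-nonNeg 0≤τ (x≤y⇒0≤y-x ∑x≤1)) ⟩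
      sum (excess τ) ∎
      where
      open PartialOrderReasoning (DecTotalOrder.poset decTotalOrder)
      split : ∀ t → w t * x t ≤ excess τ t + τ * x t
      split t with τ ≤? w t
      ... | yes _ = ≤-reflexive
        (solve 3 (λ w x τ → w :* x := x :* (w :- τ) :+ τ :* x) refl (w t) (x t) τ)
      ... | no τ≰w = ≤-by-difference
        (solve 3 (λ w x τ → con (+ 0) :* (w :- τ) :+ τ :* x :- w :* x := x :* (τ :- w)) refl
          (w t) (x t) τ)
        (*-nonNeg (0≤x t) (x≤y⇒0≤y-x (≰⇒≥ τ≰w)))

    -- A proposal is weighted by the chance that no smaller one came,
    -- which is at least 1 + massFrom times the chance q of no proposal at all.
    prophet : ∀ {τ} → 0# ≤ τ →
      let a = cut w x τ
          q = surviveAll a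
      in τ * (1# - q) + q * (sum (excess τ) + sum (λ t → excess τ t * massFrom w a (w t)))
           ≤ value w x τ
    prophet {τ} 0≤τ = begin
      τ * (1# - q) + q * (sum e + sum (λ t → e t * S t))
        -- Splitting `w t` as `τ + (w t - τ)`, this handles the `τ` part; the excess part is
        -- compared termwise at the end.
        ≤⟨ +-monoˡ-≤ _ (*-monoˡ-≤ 0≤τ (1-surviveAll≤sum w (cut-nonNeg τ) (cut≤1 τ))) ⟩
      τ * sum (λ t → a t * G t) + q * (sum e + sum (λ t → e t * S t))
        ≈⟨ +-cong (*-distribˡ-sum τ (λ t → a t * G t))
             (trans (*-congˡ (sym (∑-distrib-+ e (λ t → e t * S t))))
               (*-distribˡ-sum q (λ t → e t + e t * S t))) ⟩
      sum (λ t → τ * (a t * G t)) + sum (λ t → q * (e t + e t * S t))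
        ≈⟨ ∑-distrib-+ (λ t → τ * (a t * G t)) (λ t → q * (e t + e t * S t)) ⟨
      sum (λ t → τ * (a t * G t) + q * (e t + e t * S t))
        ≤⟨ sum-mono-≤ (λ t → ≤-by-difference
             (solve 6 (λ τ a g q w s →
                a :* g :* w :- (τ :* (a :* g) :+ q :* (a :* (w :- τ) :+ a :* (w :- τ) :* s))
                  := a :* (w :- τ) :* (g :- q :* (con (+ 1) :+ s)))
               refl τ (a t) (G t) q (w t) (S t))
             (*-nonNeg (excess-nonNeg τ t) (x≤y⇒0≤y-x
               (surviveAll*[1+massFrom]≤surviveBelow w (cut-nonNeg τ) (cut≤1 τ) (w t))))) ⟩
      value w x τ ∎
      where
      open PartialOrderReasoning (DecTotalOrder.poset decTotalOrder)
      a e S G : Fin n → Carrier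
      a = cut w x τ
      e = excess τ
      S t = massFrom w a (w t)
      G t = surviveBelow w a (w t)
      q : Carrier
      q = surviveAll a

    -- An edge surviving the cut at `τ′` exceeds `τ` by at least `τ′ - τ`, and lowering the cut to
    -- `τ` only enlarges the masses. The other edges contribute nonnegative terms.
    gap*mass≤surplus : ∀ {τ τ′} → τ ≤ τ′ →
      let y = cut w x τ′ in
      (τ′ - τ) * sum (λ t → y t * massFrom w y (w t))
        ≤ sum (λ t → excess τ t * massFrom w (cut w x τ) (w t))
    gap*mass≤surplus {τ} {τ′} τ≤τ′ = ≤-respˡ-≈ (sym (*-distribˡ-sum (τ′ - τ)
      (λ t → cut w x τ′ t * massFrom w (cut w x τ′) (w t)))) (sum-mono-≤ λ t →
      ≤-respˡ-≈ (*-assoc _ _ _) (*-mono-≤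
        (*-nonNeg (x≤y⇒0≤y-x τ≤τ′) (cut-nonNeg τ′ t))
        (massFrom-nonNeg w (cut-nonNeg τ′) (w t))
        (gap t)
        (sum-mono-≤ λ s → restrict-mono (w t ≤? w s) (cut-antitone τ≤τ′ s))))
      where
      restrict-mono : ∀ {p} {P : Set p} (d : Dec P) {y z} → y ≤ z → restrict d y ≤ restrict d z
      restrict-mono (yes _) y≤z = y≤z
      restrict-mono (no  _) y≤z = ≤-refl
      gap : ∀ t → (τ′ - τ) * cut w x τ′ t ≤ excess τ t
      gap t with τ′ ≤? w t | τ ≤? w t
      ... | yes τ′≤w | yes _   = ≤-by-difference
        (solve 4 (λ w x τ τ′ → x :* (w :- τ) :- (τ′ :- τ) :* x := x :* (w :- τ′)) refl
          (w t) (x t) τ τ′)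
        (*-nonNeg (0≤x t) (x≤y⇒0≤y-x τ′≤w))
      ... | yes τ′≤w | no  τ≰w = contradiction (≤-trans τ≤τ′ τ′≤w) τ≰w
      ... | no  _    | yes τ≤w = ≤-respˡ-≈ (sym (zeroʳ _)) (*-nonNeg (0≤x t) (x≤y⇒0≤y-x τ≤w))
      ... | no  _    | no  _   = ≤-reflexive (trans (zeroʳ _) (sym (zeroˡ _)))

    -- Mass and weight of the heavy edges when every threshold falls short.

    module Deficient (L B μ β : Carrier) (L≈∑wx : L ≈ sum (λ t → w t * x t))
             (value≤B : ∀ τ → value w x τ ≤ B)
             (½+μ<β : ½ + μ < β) (B<[½+μ]L : B < (½ + μ) * L) where

      private
        τ τ′ γ h T δ : Carrier
        τ  = (½ + μ) * L
        τ′ = β * L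
        γ  = β - ½ - μ
        h  = sum (cut w x τ′)
        T  = sum (λ t → cut w x τ′ t * massFrom w (cut w x τ′) (w t))
        δ  = sqrt (4# * μ / γ)

        0≤L : 0# ≤ L
        0≤L = ≤-respʳ-≈ (sym L≈∑wx) (sum-nonNeg λ t → *-nonNeg (0≤w t) (0≤x t))

        -- `τ` lies above `B`, which bounds a nonnegative value.
        0≤τ : 0# ≤ τ
        0≤τ = ≤-trans (≤-trans (value-nonNeg τ) (value≤B τ)) (<⇒≤ B<[½+μ]L)

        γ-assoc : β - (½ + μ) ≈ γ
        γ-assoc = solve 3 (λ b h m → b :- (h :+ m) := b :- h :- m) refl β ½ μ

        0<γ : 0# < γ
        0<γ = let 0≤d , 0≉d = x<y⇒0<y-x ½+μ<β in
          ≤-respʳ-≈ γ-assoc 0≤d , λ 0≈γ → 0≉d (trans 0≈γ (sym γ-assoc))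

        τ≤τ′ : τ ≤ τ′
        τ≤τ′ = ≤-by-difference
          (solve 4 (λ b h m l → b :* l :- (h :+ m) :* l := (b :- h :- m) :* l) refl β ½ μ L)
          (*-nonNeg (<⇒≤ 0<γ) 0≤L)

        -- By contradiction, so that `q * L` need not be shown positive and cancelled: if
        -- `2# * μ ≤ γ * T`, the prophet bound is at least `τ`, yet the value at `τ` is at most
        -- `B < τ`.
        γT≤2μ : γ * T ≤ 2# * μ
        γT≤2μ = ≰⇒≥ λ 2μ≤γT → <⇒≱ B<[½+μ]L (≤-trans (begin
          τ
            -- As `τ′ - τ` is `γ * L`, the difference is `q * L` times
            -- `γ * T - 2# * μ + (1# - 2# * ½)`. The solver treats `½` as a variable, so the last
            -- summand stays and is handled by `2*½≈1`.
            ≤⟨ ≤-by-difference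
                 (solve 6 (λ h m l b t q →
                    let ρl = (h :+ m) :* l ; 2c = con (+ 1) :+ con (+ 1) in
                    ρl :* (con (+ 1) :- q) :+ q :* (l :- ρl :+ (b :* l :- ρl) :* t) :- ρl
                      := q :* (l :* ((b :- h :- m) :* t :- 2c :* m :+ (con (+ 1) :- 2c :* h))))
                   refl ½ μ L β T q)
                 (*-nonNeg (surviveAll-nonNeg (cut≤1 τ)) (*-nonNeg 0≤L
                   (+-nonNeg (x≤y⇒0≤y-x 2μ≤γT) (x≤y⇒0≤y-x (≤-reflexive 2*½≈1))))) ⟩
          τ * (1# - q) + q * (L - τ + (τ′ - τ) * T)
            ≈⟨ +-congˡ (*-congˡ (+-congʳ (+-congʳ L≈∑wx))) ⟩
          τ * (1# - q) + q * (sum (λ t → w t * x t) - τ + (τ′ - τ) * T)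
            ≤⟨ +-mono-≤ ≤-refl (*-monoˡ-≤ (surviveAll-nonNeg (cut≤1 τ))
                 (+-mono-≤ (sum-τ≤sum-excess 0≤τ) (gap*mass≤surplus τ≤τ′))) ⟩
          τ * (1# - q)
            + q * (sum (excess τ) + sum (λ t → excess τ t * massFrom w (cut w x τ) (w t)))
            ≤⟨ prophet 0≤τ ⟩
          value w x τ ∎) (value≤B τ))
          where
          open PartialOrderReasoning (DecTotalOrder.poset decTotalOrder)
          q : Carrier
          q = surviveAll (cut w x τ)

        -- One factor 2 comes from counting pairs of edges, the other from the `2# * μ` of the
        -- prophet bound.
        γh²≤4μ : γ * (h * h) ≤ 4# * μ
        γh²≤4μ = begin
          γ * (h * h)       ≤⟨ *-monoˡ-≤ (<⇒≤ 0<γ) (sum²≤2*sum*massFrom w (cut-nonNeg τ′)) ⟩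
          γ * (2# * T)      ≈⟨ solve 3 (λ g c t → g :* (c :* t) := c :* (g :* t)) refl γ 2# T ⟩
          2# * (γ * T)      ≤⟨ *-monoˡ-≤ (<⇒≤ 0<2) γT≤2μ ⟩
          2# * (2# * μ)     ≈⟨ solve 1 (λ m → let 2c = con (+ 1) :+ con (+ 1) in
                                  2c :* (2c :* m) := (2c :+ 2c) :* m) refl μ ⟩
          4# * μ            ∎
          where open PartialOrderReasoning (DecTotalOrder.poset decTotalOrder)

        h≤δ : h ≤ δ
        h≤δ = x*x≤y⇒x≤sqrt h²≤4μ/γ
          -- `sqrt` is specified only at nonnegative arguments; the radicand is one because it is at
          -- least `h * h`.
          (≤-trans (*-nonNeg 0≤h 0≤h) h²≤4μ/γ)
          where
          h²≤4μ/γ : h * h ≤ 4# * μ / γ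
          h²≤4μ/γ = z*x≤y⇒x≤y/z 0<γ γh²≤4μ
          0≤h : 0# ≤ h
          0≤h = sum-nonNeg (cut-nonNeg τ′)

        0≤x*𝟙 : ∀ t → 0# ≤ x t * 𝟙 (τ′ <? w t)
        0≤x*𝟙 t = *-nonNeg (0≤x t) (restrict-nonNeg (τ′ <? w t) 0≤1)

        -- The indicator is strict and the cut is not, so the cut may additionally contain edges of
        -- weight exactly `τ′`.
        x*𝟙≤cut : ∀ t → x t * 𝟙 (τ′ <? w t) ≤ cut w x τ′ t
        x*𝟙≤cut t = if-elim (λ i → x t * i ≤ cut w x τ′ t) (τ′ <? w t)
          (λ τ′<w → if-elim (x t * 1# ≤_) (τ′ ≤? w t)
            (λ _ → ≤-reflexive (*-identityʳ _)) (contradiction (<⇒≤ τ′<w)))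
          (λ _ → ≤-respˡ-≈ (sym (zeroʳ _)) (cut-nonNeg τ′ t))

      heavyMass≤δ : sum (λ t → x t * 𝟙 (τ′ <? w t)) ≤ δ
      heavyMass≤δ = ≤-trans (sum-mono-≤ x*𝟙≤cut) h≤δ

      -- The premise makes `1# - δ` a positive divisor. With `h ≤ δ`, the estimate
      -- `[1-sum]*sum≤value` at `τ′` bounds `(1# - δ) * z` by `B`.
      heavyWeight≤ : δ < 1# →
        sum (λ t → x t * w t * 𝟙 (τ′ <? w t)) ≤ (½ + μ) / (1# - δ) * L
      heavyWeight≤ δ<1 = begin
        sum (λ t → x t * w t * 𝟙 (τ′ <? w t))
          ≤⟨ sum-mono-≤ (λ t → ≤-respˡ-≈
               (solve 3 (λ x w i → x :* i :* w := x :* w :* i) refl (x t) (w t) _)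
               (*-mono-≤ (0≤x*𝟙 t) (0≤w t) (x*𝟙≤cut t) ≤-refl)) ⟩
        z
          ≤⟨ z*x≤y⇒x≤y/z (x<y⇒0<y-x δ<1) bound ⟩
        (½ + μ) * L / (1# - δ)
          ≈⟨ solve 3 (λ r l i → r :* l :* i := r :* i :* l) refl (½ + μ) L _ ⟩
        (½ + μ) / (1# - δ) * L ∎
        where
        open PartialOrderReasoning (DecTotalOrder.poset decTotalOrder)
        z : Carrier
        z = sum (λ t → cut w x τ′ t * w t)
        0≤z : 0# ≤ z
        0≤z = sum-nonNeg λ t → *-nonNeg (cut-nonNeg τ′ t) (0≤w t)
        bound : (1# - δ) * z ≤ (½ + μ) * L
        bound = begin
          (1# - δ) * z
            ≤⟨ ≤-by-difference
                 (solve 3 (λ d h z → (con (+ 1) :- h) :* z :- (con (+ 1) :- d) :* z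
                                  := (d :- h) :* z) refl δ h z)
                 (*-nonNeg (x≤y⇒0≤y-x h≤δ) 0≤z) ⟩
          (1# - h) * z      ≤⟨ [1-sum]*sum≤value τ′ ⟩
          value w x τ′      ≤⟨ value≤B τ′ ⟩
          B                 ≤⟨ <⇒≤ B<[½+μ]L ⟩
          (½ + μ) * L       ∎

lemma4p1 :
    ∀ {c ℓ₁ ℓ₂} (F : EuclideanField c ℓ₁ ℓ₂) →
    let open EuclideanField F
        open Matching F
    in
    ∀ (k n : ℕ) (w : Fin k → Fin n → Carrier) (p : Fin n → Carrier) →
    (∀ i t → 0# ≤ w i t) →
    (∀ t → 0# ≤ p t × p t ≤ 1#) →
    ∀ (i : Fin k) (x : Fin k → Fin n → Carrier) → x ∈𝒫 p →
    ∀ (μ β : Carrier) → μ < ½ → ½ + μ < β →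
    LB w x i < (½ + μ) * LP w x i →
    let δ = sqrt (4# * μ / (β - ½ - μ)) in
    sum (λ t → x i t * 𝟙 (β * LP w x i <? w i t)) ≤ δ
    ×
    (δ < 1# →
      sum (λ t → x i t * w i t * 𝟙 (β * LP w x i <? w i t))
        ≤ (½ + μ) / (1# - δ) * LP w x i)
lemma4p1 F k n w p 0≤w _ i x x∈𝒫 μ β _ ½+μ<β LB<[½+μ]LP =
  heavyMass≤δ , heavyWeight≤
  where
  open EuclideanField F
  open Matching F
  open _∈𝒫_ x∈𝒫
  open FixedThreshold F
  -- Maximality of `LB` over all thresholds permits the choice of both `(½ + μ) * LP` and `β * LP`.
  value≤LB : ∀ τ → value (w i) (x i) τ ≤ LB w x i
  value≤LB τ = ≤-respˡ-≈ (thresholdValue≈value w x i τ)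
    (proj₂ (proj₂ (thresholdValue-maximum w x i)) τ)
  open Deficient (w i) (x i) (0≤w i) (nonNeg i) (offline i) (LP w x i) (LB w x i) μ β
    refl value≤LB ½+μ<β LB<[½+μ]LP
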